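{- The only pair $(n,x)$ of positive integers with $n\geq 2$ satisfying $(4^{n}-2)(100^{n}-2)=x^{2}$ is $(n,x)=(3,7874)$. -}

module Defs where

-- Put N = 4ⁿ = m + 2 and k = 5ⁿ.  The Pell descent step
-- q = k (N − 1) − x  turns  x² = (N − 2)(k² N − 2)  into the quadric
-- q² + k² + 2 m = 2 k q (N − 1), which is the recurrence for consecutive
-- solutions.  Since 5ⁿ is well below 8ⁿ, q is smaller than 2ⁿ, so that
-- q² + 2 m < 3 · 4ⁿ < 5ⁿ = k as soon as n ≥ 5; but the quadric shows that k
-- divides the positive number q² + 2 m.
module Submission where

open import Defs
open import Data.Nat using (ℕ; _*_; _^_; _∸_; _≥_; _>_)
open import Data.Product using (_×_; _,_)
open import Function.Bundles using (_⇔_)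
open import Relation.Binary.PropositionalEquality using (_≡_)

open import Data.Empty using (⊥)
open import Data.Nat using (zero; suc; _+_; _≤_; _<_; s≤s; s≤s⁻¹; z<s; _<?_; _≤?_; NonZero; >-nonZero)
open import Data.Nat.Divisibility using (_∣_; ∣m+n∣m⇒∣n; ∣⇒≤; m∣m*n)
open import Data.Nat.Properties
open import Data.Nat.Tactic.RingSolver using (solve-∀)
open import Function.Bundles using (mk⇔)
open import Relation.Nullary.Decidable using (True; toWitness; from-yes)
open import Relation.Nullary.Negation using (contradiction)
open import Relation.Binary.PropositionalEquality using (_≢_; refl; sym; trans; cong; cong₂; subst)

square-cancel-≤ : ∀ {a b} → a * a ≤ b * b → a ≤ b
square-cancel-≤ a²≤b² = ≮⇒≥ λ b<a → <⇒≱ (*-mono-< b<a b<a) a²≤b²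

square-cancel-< : ∀ {a b} → a * a < b * b → a < b
square-cancel-< a²<b² = ≰⇒> λ b≤a → <⇒≱ a²<b² (*-mono-≤ b≤a b≤a)

square-injective : ∀ {a b} → a * a ≡ b * b → a ≡ b
square-injective eq =
  ≤-antisym (square-cancel-≤ (≤-reflexive eq)) (square-cancel-≤ (≤-reflexive (sym eq)))

-- An integer strictly between consecutive squares is not a square. The bounds are implicit `True`
-- arguments, so for literals evaluation supplies them.
between-squares : ∀ {c} a {_ : True (a * a <? c)} {_ : True (c <? suc a * suc a)} →
                  ∀ x → c ≢ x * x
between-squares a {a²<c} {c<[1+a]²} x refl =
  <⇒≱ (square-cancel-< {a} {x} (toWitness a²<c))
      (s≤s⁻¹ (square-cancel-< {x} {suc a} (toWitness c<[1+a]²)))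

^-distribʳ-* : ∀ a b n → (a * b) ^ n ≡ a ^ n * b ^ n
^-distribʳ-* a b zero    = refl
^-distribʳ-* a b (suc n) =
  trans (cong (a * b *_) (^-distribʳ-* a b n)) ([m*n]*[o*p]≡[m*o]*[n*p] a b (a ^ n) (b ^ n))

-- Raising the exponent multiplies the left side by `a` and the right by `b`, and `a ≤ b`. One
-- numerical check thus settles all later exponents.
^-dominates : ∀ {a b} c n .{{_ : NonZero b}} → a ≤ b → c * a ^ n < b ^ n →
              ∀ j → c * a ^ (j + n) < b ^ (j + n)
^-dominates c n a≤b base zero = base
^-dominates {a} {b} c n a≤b base (suc j) = begin-strict
  c * (a * a ^ (j + n))  ≡⟨ x∙yz≈y∙xz c a (a ^ (j + n)) ⟩
  a * (c * a ^ (j + n))  ≤⟨ *-monoˡ-≤ (c * a ^ (j + n)) a≤b ⟩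
  b * (c * a ^ (j + n))  <⟨ *-monoʳ-< b (^-dominates c n a≤b base j) ⟩
  b * b ^ (j + n)        ∎
  where
  open ≤-Reasoning
  x∙yz≈y∙xz : ∀ x y z → x * (y * z) ≡ y * (x * z)
  x∙yz≈y∙xz = solve-∀

module Descent {m k x y : ℕ} (2+y≡k²N : 2 + y ≡ k * k * (2 + m)) (my≡x² : m * y ≡ x * x) where

  open ≤-Reasoning

  -- Completing the square: with N = 2 + m, the product N (N - 2) is (1 + m)² - 1.
  x²+k²+2m≡[k[1+m]]² : x * x + (k * k + 2 * m) ≡ (k * (1 + m)) * (k * (1 + m))
  x²+k²+2m≡[k[1+m]]² = begin-equality
    x * x + (k * k + 2 * m)          ≡⟨ cong (_+ (k * k + 2 * m)) my≡x² ⟨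
    m * y + (k * k + 2 * m)          ≡⟨ regroup m y (k * k) ⟩
    m * (2 + y) + k * k              ≡⟨ cong (λ z → m * z + k * k) 2+y≡k²N ⟩
    m * (k * k * (2 + m)) + k * k    ≡⟨ complete m k ⟩
    (k * (1 + m)) * (k * (1 + m))    ∎
    where
    regroup : ∀ m y s → m * y + (s + 2 * m) ≡ m * (2 + y) + s
    regroup = solve-∀
    complete : ∀ m k → m * (k * k * (2 + m)) + k * k ≡ (k * (1 + m)) * (k * (1 + m))
    complete = solve-∀

  x≤k[1+m] : x ≤ k * (1 + m)
  x≤k[1+m] = square-cancel-≤ (≤-trans (m≤m+n (x * x) _) (≤-reflexive x²+k²+2m≡[k[1+m]]²))

  -- The truncated subtraction is exact by `x≤k[1+m]`.
  q : ℕ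
  q = k * (1 + m) ∸ x

  x+q≡k[1+m] : x + q ≡ k * (1 + m)
  x+q≡k[1+m] = m+[n∸m]≡n x≤k[1+m]

  q²+2xq≡k²+2m : q * q + 2 * (x * q) ≡ k * k + 2 * m
  q²+2xq≡k²+2m = +-cancelˡ-≡ (x * x) _ _ (begin-equality
    x * x + (q * q + 2 * (x * q))  ≡⟨ expand x q ⟩
    (x + q) * (x + q)              ≡⟨ cong₂ _*_ x+q≡k[1+m] x+q≡k[1+m] ⟩
    (k * (1 + m)) * (k * (1 + m))  ≡⟨ x²+k²+2m≡[k[1+m]]² ⟨
    x * x + (k * k + 2 * m)        ∎)
    where
    expand : ∀ x q → x * x + (q * q + 2 * (x * q)) ≡ (x + q) * (x + q)
    expand = solve-∀

  k[q[1+m]]≡[x+q]q : k * (q * (1 + m)) ≡ (x + q) * q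
  k[q[1+m]]≡[x+q]q = trans (swap k q (1 + m)) (cong (_* q) (sym x+q≡k[1+m]))
    where
    swap : ∀ k q p → k * (q * p) ≡ k * p * q
    swap = solve-∀

  -- Adding q² to both sides of `q²+2xq≡k²+2m` makes the left side 2 (x + q) q, and x + q = k (1 +
  -- m) then eliminates x.
  quadric : k * (2 * (q * (1 + m))) ≡ k * k + (q * q + 2 * m)
  quadric = begin-equality
    k * (2 * (q * (1 + m)))      ≡⟨ double k (q * (1 + m)) ⟩
    2 * (k * (q * (1 + m)))      ≡⟨ cong (2 *_) k[q[1+m]]≡[x+q]q ⟩
    2 * ((x + q) * q)            ≡⟨ expand x q ⟩
    q * q + 2 * (x * q) + q * q  ≡⟨ cong (_+ q * q) q²+2xq≡k²+2m ⟩
    k * k + 2 * m + q * q        ≡⟨ regroup (k * k) m (q * q) ⟩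
    k * k + (q * q + 2 * m)      ∎
    where
    double : ∀ k p → k * (2 * p) ≡ 2 * (k * p)
    double = solve-∀
    expand : ∀ x q → 2 * ((x + q) * q) ≡ q * q + 2 * (x * q) + q * q
    expand = solve-∀
    regroup : ∀ s m t → s + 2 * m + t ≡ s + (t + 2 * m)
    regroup = solve-∀

  k∣q²+2m : k ∣ q * q + 2 * m
  k∣q²+2m = ∣m+n∣m⇒∣n (subst (k ∣_) quadric (m∣m*n _)) (m∣m*n k)

  -- The smallness of 2 m puts k² + 2 m below k (k + 1); cancelling k leaves a strict bound by k +
  -- 1.
  q[1+m]≤k : 2 * m < k → q * (1 + m) ≤ k
  q[1+m]≤k 2m<k = s≤s⁻¹ (*-cancelˡ-< k _ _ (begin-strict
    k * (q * (1 + m))    ≡⟨ k[q[1+m]]≡[x+q]q ⟩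
    (x + q) * q          ≤⟨ m≤m+n _ (x * q) ⟩
    (x + q) * q + x * q  ≡⟨ expand x q ⟩
    q * q + 2 * (x * q)  ≡⟨ q²+2xq≡k²+2m ⟩
    k * k + 2 * m        <⟨ +-monoʳ-< (k * k) 2m<k ⟩
    k * k + k            ≡⟨ +-comm (k * k) k ⟩
    k + k * k            ≡⟨ *-suc k k ⟨
    k * suc k            ∎))
    where
    expand : ∀ x q → (x + q) * q + x * q ≡ q * q + 2 * (x * q)
    expand = solve-∀

  -- Passing from 1 + m to N = 2 + m costs at most a factor 2, since 2 + m ≤ 2 (1 + m).
  q<u : ∀ u → 2 * m < k → 2 * k < u * (2 + m) → q < u
  q<u u 2m<k 2k<uN = *-cancelʳ-< (2 + m) q u (begin-strict
    q * (2 + m)          ≤⟨ m≤m+n _ (q * m) ⟩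
    q * (2 + m) + q * m  ≡⟨ expand q m ⟩
    2 * (q * (1 + m))    ≤⟨ *-monoʳ-≤ 2 (q[1+m]≤k 2m<k) ⟩
    2 * k                <⟨ 2k<uN ⟩
    u * (2 + m)          ∎)
    where
    expand : ∀ q m → q * (2 + m) + q * m ≡ 2 * (q * (1 + m))
    expand = solve-∀

  -- Here `u` stands for 2ⁿ, so the last two hypotheses read 3 · 4ⁿ < 5ⁿ and 2 · 5ⁿ < 8ⁿ.
  absurd : ∀ u → 0 < m → u * u ≡ 2 + m → 3 * (2 + m) < k → 2 * k < u * (2 + m) → ⊥
  absurd u 0<m u²≡N 3N<k 2k<uN = <⇒≱ q²+2m<k (∣⇒≤ k∣q²+2m)
    where
    2m≤2N : 2 * m ≤ 2 * (2 + m)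
    2m≤2N = *-monoʳ-≤ 2 (m≤n+m m 2)
    2m<k : 2 * m < k
    2m<k = ≤-<-trans (≤-trans 2m≤2N (m≤n+m _ (2 + m))) 3N<k
    q<u′ : q < u
    q<u′ = q<u u 2m<k 2k<uN
    q²+2m<k : q * q + 2 * m < k
    q²+2m<k = begin-strict
      q * q + 2 * m            <⟨ +-mono-<-≤ (*-mono-< q<u′ q<u′) 2m≤2N ⟩
      u * u + 2 * (2 + m)      ≡⟨ cong (_+ 2 * (2 + m)) u²≡N ⟩
      3 * (2 + m)              <⟨ 3N<k ⟩
      k                        ∎
    -- `∣⇒≤` bounds divisors of nonzero numbers only; `0<m` provides this.
    instance
      q²+2m≢0 : NonZero (q * q + 2 * m)
      q²+2m≢0 = >-nonZero (≤-trans 0<m (≤-trans (m≤m+n m _) (m≤n+m (2 * m) (q * q))))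

no-square-beyond-4 : ∀ n x → 5 ≤ n → (4 ^ n ∸ 2) * (100 ^ n ∸ 2) ≢ x * x
no-square-beyond-4 n x 5≤n eq =
  Descent.absurd {x = x} 2+y≡k²N eq (2 ^ n) (m<n⇒0<n∸m 2<4ⁿ) u²≡N 3N<k 2k<uN
  where
  2<4ⁿ : 2 < 4 ^ n
  2<4ⁿ = ≤-trans (from-yes (2 <? 4 ^ 5)) (^-monoʳ-≤ 4 5≤n)
  2≤100ⁿ : 2 ≤ 100 ^ n
  2≤100ⁿ = ≤-trans (from-yes (2 ≤? 100 ^ 5)) (^-monoʳ-≤ 100 5≤n)
  N≡4ⁿ : 2 + (4 ^ n ∸ 2) ≡ 4 ^ n
  N≡4ⁿ = m+[n∸m]≡n (<⇒≤ 2<4ⁿ)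
  2+y≡k²N : 2 + (100 ^ n ∸ 2) ≡ 5 ^ n * 5 ^ n * (2 + (4 ^ n ∸ 2))
  2+y≡k²N = trans (m+[n∸m]≡n 2≤100ⁿ)
    (trans (^-distribʳ-* 25 4 n) (cong₂ _*_ (^-distribʳ-* 5 5 n) (sym N≡4ⁿ)))
  u²≡N : 2 ^ n * 2 ^ n ≡ 2 + (4 ^ n ∸ 2)
  u²≡N = trans (sym (^-distribʳ-* 2 2 n)) (sym N≡4ⁿ)
  dominates : ∀ {a b} c .{{_ : NonZero b}} → a ≤ b → c * a ^ 5 < b ^ 5 → c * a ^ n < b ^ n
  dominates {a} {b} c a≤b base =
    subst (λ i → c * a ^ i < b ^ i) (m∸n+n≡m 5≤n) (^-dominates c 5 a≤b base (n ∸ 5))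
  3N<k : 3 * (2 + (4 ^ n ∸ 2)) < 5 ^ n
  3N<k = subst (λ N → 3 * N < 5 ^ n) (sym N≡4ⁿ)
    -- 3072 < 3125. At n = 4 the inequality fails (768 > 625), so that exponent is treated
    -- separately.
    (dominates 3 (from-yes (4 ≤? 5)) (from-yes (3 * 4 ^ 5 <? 5 ^ 5)))
  2k<uN : 2 * 5 ^ n < 2 ^ n * (2 + (4 ^ n ∸ 2))
  2k<uN = subst (2 * 5 ^ n <_) (trans (^-distribʳ-* 2 4 n) (cong (2 ^ n *_) (sym N≡4ⁿ)))
    (dominates 2 (from-yes (5 ≤? 8)) (from-yes (2 * 5 ^ 5 <? 8 ^ 5)))

unique-solution : ∀ n x → 2 ≤ n → (4 ^ n ∸ 2) * (100 ^ n ∸ 2) ≡ x * x → (n , x) ≡ (3 , 7874)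
unique-solution 0 x () eq
unique-solution 1 x (s≤s ()) eq
unique-solution 2 x _ eq =
  -- 374² = 139876 < 14 · 9998 = 139972 < 140625 = 375².
  contradiction eq (between-squares 374 x)
-- 62 · 999998 evaluates to 7874², as 62 = 2 · 31 and 999998 = 2 · 31 · 127².
unique-solution 3 x _ eq = cong (3 ,_) (square-injective (sym eq))
unique-solution 4 x _ eq =
  -- The product is 254 · 99999998, between 159373² and 159374².
  contradiction eq (between-squares 159373 x)
unique-solution n@(suc (suc (suc (suc (suc j))))) x _ eq =
  contradiction eq (no-square-beyond-4 n x (m≤m+n 5 j))

corollary28 : ∀ (n x : ℕ) →
    (n ≥ 2 × x > 0 × (4 ^ n ∸ 2) * (100 ^ n ∸ 2) ≡ x ^ 2) ⇔ ((n , x) ≡ (3 , 7874))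
corollary28 n x = mk⇔
  (λ (2≤n , _ , eq) → unique-solution n x 2≤n (trans eq (cong (x *_) (*-identityʳ x))))
  (λ { refl → from-yes (2 ≤? 3) , z<s , refl })
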